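{- The direct limit of a sequence of Ramsey algebras need not be a Ramsey algebra: there exists a direct system $\mathcal{A}_0\to\mathcal{A}_1\to\mathcal{A}_2\to\cdots$, indexed by $\omega$, of algebras of a common language and homomorphisms between them, such that every $\mathcal{A}_n$ is a Ramsey algebra but the direct limit of the system is not a Ramsey algebra.
   Context: An algebra $\mathcal{A}=(A,\mathcal{F})$ consists of a set $A$ and a family $\mathcal{F}$ of finitary operations $f:A^n\to A$ on $A$. When $\mathcal{L}$ is a set of function symbols (a purely functional language), an algebra of the language $\mathcal{L}$ is an $\mathcal{L}$-structure, $\mathcal{F}$ being the family of interpretations of the symbols; direct limit is in the usual model-theoretic sense for $\mathcal{L}$-structures. An $n$-ary $f$ is an orderly composition of a family $\mathcal{G}$ of operations if there are a $k$-ary $g\in\mathcal{G}$ and $n_j$-ary $h_j\in\mathcal{G}$ ($1\le j\le k$) with $\sum_{j=1}^k n_j=n$ such that $f(x_1,\dots,x_n)=g(h_1(\bar x_1),\dots,h_k(\bar x_k))$, where $\bar x_1,\dots,\bar x_k$ are the consecutive blocks of $(x_1,\dots,x_n)$ of lengths $n_1,\dots,n_k$. The set $\mathrm{OT}(\mathcal{F})$ of orderly terms over $\mathcal{F}$ is the smallest collection of operations on $A$ that contains $\mathcal{F}\cup\{\mathrm{id}_A\}$ and is closed under orderly composition. For infinite sequences $\vec a,\vec b\in{}^\omega A$, $\vec a$ is a reduction of $\vec b$, written $\vec a\le_{\mathcal{F}}\vec b$, if there are orderly terms $f_j\in\mathrm{OT}(\mathcal{F})$ and finite subsequences $\vec b_j$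 of $\vec b$ ($j\in\omega$) such that $\vec a(j)=f_j(\vec b_j)$ for every $j$ and the concatenation $\vec b_0*\vec b_1*\cdots$ is a subsequence of $\vec b$. Put $\mathrm{FR}_{\mathcal{F}}(\vec b)=\{\vec a(0):\vec a\le_{\mathcal{F}}\vec b\}$. The algebra $(A,\mathcal{F})$ is a Ramsey algebra if for every $\vec b\in{}^\omega A$ and every $X\subseteq A$ there is $\vec a\le_{\mathcal{F}}\vec b$ such that $\mathrm{FR}_{\mathcal{F}}(\vec a)$ is either contained in $X$ or disjoint from $X$. -}

module Defs where

open import Level using (0ℓ)
open import Data.Fin.Base as Fin using (Fin; zero; suc)
open import Data.Nat.Base
  using (ℕ; suc; _⊔_; _<_; _≤′_; ≤′-reflexive; ≤′-refl; ≤′-step)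
open import Data.Nat.Properties
  using (≡-irrelevant; 1+n≰n; ≤′⇒≤; ≤⇒≤′; ≤′-trans; m≤m⊔n; m≤n⊔m)
open import Data.Product.Base using (Σ; ∃-syntax; _×_; _,_; proj₂)
open import Data.Sum.Base using (_⊎_)
open import Data.Vec.Base as Vec using (Vec; []; _∷_)
open import Data.Vec.Relation.Binary.Pointwise.Inductive
  using (Pointwise; []; _∷_)
open import Function.Base using (_∘_)
open import Relation.Binary.Bundles using (Setoid)
open import Relation.Binary.Definitions using (_Respects_)
open import Relation.Binary.PropositionalEquality.Core using (_≡_; refl)
open import Relation.Nullary.Negation.Core using (contradiction)
open import Relation.Unary using (Pred; _⊆_; _⊥_)

------------------------------------------------------------------------
-- Ramsey algebras

-- The underlying set of an algebra is a setoid, since a direct limit is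
-- a quotient.  Equality of elements always means _≈_, and subsets are
-- predicates respecting _≈_.

module Ramsey (𝔸 : Setoid 0ℓ 0ℓ) where
  open Setoid 𝔸 renaming (Carrier to A)

  Op : ℕ → Set
  Op n = Vec A n → A

  Family : Set₁
  Family = ∀ {n} → Op n → Set

  -- Cuts the argument list into consecutive blocks of lengths n₁, …, nₖ
  -- and applies hⱼ to the j-th block.
  applyBlocks : ∀ {k} (ns : Vec ℕ k) → (∀ j → Op (Vec.lookup ns j)) →
                Vec A (Vec.sum ns) → Vec A k
  applyBlocks []       hs xs = []
  applyBlocks (n ∷ ns) hs xs =
    hs zero (Vec.take n xs) ∷ applyBlocks ns (λ j → hs (suc j)) (Vec.drop n xs)

  data OrderlyComposition (𝓖 : Family) : Family where
    orderly : ∀ {k} {g : Op k} {ns : Vec ℕ k}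
              {hs : ∀ j → Op (Vec.lookup ns j)} {f : Op (Vec.sum ns)} →
              𝓖 g → (∀ j → 𝓖 (hs j)) →
              (∀ xs → f xs ≈ g (applyBlocks ns hs xs)) →
              OrderlyComposition 𝓖 f

  data OT (𝓕 : Family) : Family where
    basic    : ∀ {n} {f : Op n} → 𝓕 f → OT 𝓕 f
    identity : OT 𝓕 {1} Vec.head
    compose  : ∀ {n} {f : Op n} → OrderlyComposition (OT 𝓕) f → OT 𝓕 f

  Seq : Set
  Seq = ℕ → A

  -- The finite sequence b⃗ⱼ consists of the entries of b⃗ at the positions
  -- index j 0, …, index j (length j - 1).  The two monotonicity conditions
  -- together say that the concatenation of all these lists of positions is
  -- strictly increasing, i.e. that b⃗₀ * b⃗₁ * ⋯ is a subsequence of b⃗.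
  record Reduction (𝓕 : Family) (a b : Seq) : Set where
    field
      length : ℕ → ℕ
      index  : ∀ j → Fin (length j) → ℕ
      within : ∀ j {p q} → p Fin.< q → index j p < index j q
      across : ∀ {i j} → i < j → ∀ p q → index i p < index j q
      term   : ∀ j → Op (length j)
      isTerm : ∀ j → OT 𝓕 (term j)
      value  : ∀ j → a j ≈ term j (Vec.tabulate (b ∘ index j))

  FR : Family → Seq → Pred A 0ℓ
  FR 𝓕 b x = ∃[ a ] (Reduction 𝓕 a b × a 0 ≈ x)

  IsRamsey : Family → Set₁
  IsRamsey 𝓕 = ∀ (b : Seq) (X : Pred A 0ℓ) → X Respects _≈_ →
    ∃[ a ] (Reduction 𝓕 a b × (FR 𝓕 a ⊆ X ⊎ FR 𝓕 a ⊥ X))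

------------------------------------------------------------------------
-- Algebras of a purely functional language

record Language : Set₁ where
  field
    Symbol : Set
    arity  : Symbol → ℕ

record Algebra (L : Language) : Set₁ where
  open Language L
  field
    setoid : Setoid 0ℓ 0ℓ
  open Setoid setoid public
  field
    interp      : ∀ s → Vec Carrier (arity s) → Carrier
    interp-cong : ∀ s {xs ys} → Pointwise _≈_ xs ys → interp s xs ≈ interp s ys

module _ {L : Language} (𝒜 : Algebra L) where
  open Language L
  open Algebra 𝒜
  open Ramsey setoid

  data Operation : Family where
    interpretation : ∀ s → Operation (interp s)

  IsRamseyAlgebra : Set₁
  IsRamseyAlgebra = IsRamsey Operation

record Hom {L : Language} (𝒜 ℬ : Algebra L) : Set where
  open Language L
  private
    module 𝒜 = Algebra 𝒜
    module ℬ = Algebra ℬ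
  field
    to       : 𝒜.Carrier → ℬ.Carrier
    to-cong  : ∀ {x y} → x 𝒜.≈ y → to x ℬ.≈ to y
    preserve : ∀ s xs → to (𝒜.interp s xs) ℬ.≈ ℬ.interp s (Vec.map to xs)

------------------------------------------------------------------------
-- Direct systems indexed by ω and their direct limits

-- The maps between consecutive algebras determine all the others by
-- composition.
record DirectSystem (L : Language) : Set₁ where
  field
    algebra : ℕ → Algebra L
    hom     : ∀ n → Hom (algebra n) (algebra (suc n))

module _ {L : Language} (𝒮 : DirectSystem L) where
  open Language L
  open DirectSystem 𝒮

  private
    module 𝒜 (n : ℕ) = Algebra (algebra n)
    module φ (n : ℕ) = Hom (hom n)

  transition : ∀ {m n} → m ≤′ n → 𝒜.Carrier m → 𝒜.Carrier n
  transition ≤′-refl            x = x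
  transition (≤′-step {n} m≤n) x = φ.to n (transition m≤n x)

  transition-cong : ∀ {m n} (m≤n : m ≤′ n) {x y} → 𝒜._≈_ m x y →
                    𝒜._≈_ n (transition m≤n x) (transition m≤n y)
  transition-cong ≤′-refl            x≈y = x≈y
  transition-cong (≤′-step {n} m≤n) x≈y = φ.to-cong n (transition-cong m≤n x≈y)

  transition-preserve :
    ∀ {m n} (m≤n : m ≤′ n) s xs →
    𝒜._≈_ n (transition m≤n (𝒜.interp m s xs))
             (𝒜.interp n s (Vec.map (transition m≤n) xs))
  transition-preserve {m} ≤′-refl s xs = 𝒜.interp-cong m s (xs≈id xs)
    where
    xs≈id : ∀ {k} (ys : Vec (𝒜.Carrier m) k) →
            Pointwise (𝒜._≈_ m) ys (Vec.map (transition ≤′-refl) ys)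
    xs≈id []       = []
    xs≈id (y ∷ ys) = 𝒜.refl m ∷ xs≈id ys
  transition-preserve {m} (≤′-step {n} m≤n) s xs =
    𝒜.trans (suc n) (φ.to-cong n (transition-preserve m≤n s xs))
      (𝒜.trans (suc n) (φ.preserve n s (Vec.map (transition m≤n) xs))
        (𝒜.interp-cong (suc n) s (fuse xs)))
    where
    fuse : ∀ {k} (ys : Vec (𝒜.Carrier m) k) →
           Pointwise (𝒜._≈_ (suc n))
             (Vec.map (φ.to n) (Vec.map (transition m≤n) ys))
             (Vec.map (transition (≤′-step m≤n)) ys)
    fuse []       = []
    fuse (y ∷ ys) = 𝒜.refl (suc n) ∷ fuse ys

  transition-irrelevant : ∀ {m n} (p q : m ≤′ n) x →
                          𝒜._≈_ n (transition p x) (transition q x)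
  transition-irrelevant {m} ≤′-refl q x = loop q refl
    where
    loop : ∀ {n} (q : m ≤′ n) (eq : m ≡ n) →
           𝒜._≈_ n (transition (≤′-reflexive eq) x) (transition q x)
    loop ≤′-refl     eq   = lemma eq
      where
      lemma : (eq : m ≡ m) → 𝒜._≈_ m (transition (≤′-reflexive eq) x) x
      lemma eq with refl ← ≡-irrelevant eq refl = 𝒜.refl m
    loop (≤′-step q) refl = contradiction (≤′⇒≤ q) 1+n≰n
  transition-irrelevant (≤′-step p) ≤′-refl x = contradiction (≤′⇒≤ p) 1+n≰n
  transition-irrelevant (≤′-step {n} p) (≤′-step q) x =
    φ.to-cong n (transition-irrelevant p q x)

  transition-∘ : ∀ {l m n} (p : l ≤′ m) (q : m ≤′ n) (r : l ≤′ n) x →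
                 𝒜._≈_ n (transition q (transition p x)) (transition r x)
  transition-∘ {n = n} p q r x =
    𝒜.trans n (split p q) (transition-irrelevant (≤′-trans p q) r x)
    where
    split : ∀ {m n} (p : _ ≤′ m) (q : m ≤′ n) →
            𝒜._≈_ n (transition q (transition p x)) (transition (≤′-trans p q) x)
    split {m} p ≤′-refl         = 𝒜.refl m
    split p (≤′-step {n} q) = φ.to-cong n (split p q)

  Element : Set
  Element = Σ ℕ 𝒜.Carrier

  infix 4 _∼_
  _∼_ : Element → Element → Set
  (m , x) ∼ (n , y) =
    ∃[ p ] Σ (m ≤′ p) λ m≤p → Σ (n ≤′ p) λ n≤p →
      𝒜._≈_ p (transition m≤p x) (transition n≤p y)

  -- Images that agree at some stage agree at every later one.
  ∼-later : ∀ {m n p q x y} (m≤p : m ≤′ p) (n≤p : n ≤′ p) →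
            𝒜._≈_ p (transition m≤p x) (transition n≤p y) →
            p ≤′ q → (m≤q : m ≤′ q) (n≤q : n ≤′ q) →
            𝒜._≈_ q (transition m≤q x) (transition n≤q y)
  ∼-later {q = q} {x} {y} m≤p n≤p x≈y p≤q m≤q n≤q =
    𝒜.trans q (𝒜.sym q (transition-∘ m≤p p≤q m≤q x))
      (𝒜.trans q (transition-cong p≤q x≈y) (transition-∘ n≤p p≤q n≤q y))

  private
    left : ∀ m n → m ≤′ m ⊔ n
    left m n = ≤⇒≤′ (m≤m⊔n m n)

    right : ∀ m n → n ≤′ m ⊔ n
    right m n = ≤⇒≤′ (m≤n⊔m m n)

  ∼-refl : ∀ {u} → u ∼ u
  ∼-refl {m , x} = m , ≤′-refl , ≤′-refl , 𝒜.refl m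

  ∼-sym : ∀ {u v} → u ∼ v → v ∼ u
  ∼-sym (p , m≤p , n≤p , x≈y) = p , n≤p , m≤p , 𝒜.sym p x≈y

  ∼-trans : ∀ {u v w} → u ∼ v → v ∼ w → u ∼ w
  ∼-trans (p , l≤p , m≤p , x≈y) (q , m≤q , n≤q , y≈z) =
    p ⊔ q , ≤′-trans l≤p p≤ , ≤′-trans n≤q q≤ ,
    𝒜.trans (p ⊔ q)
      (∼-later l≤p m≤p x≈y p≤ (≤′-trans l≤p p≤) (≤′-trans m≤p p≤))
      (∼-later m≤q n≤q y≈z q≤ (≤′-trans m≤p p≤) (≤′-trans n≤q q≤))
    where
    p≤ = left p q
    q≤ = right p q

  limitSetoid : Setoid 0ℓ 0ℓ
  limitSetoid = record
    { Carrier       = Element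
    ; _≈_           = _∼_
    ; isEquivalence = record { refl = ∼-refl ; sym = ∼-sym ; trans = ∼-trans }
    }

  -- Moves finitely many elements to a common stage.
  align : ∀ {k} → Vec Element k → ∃[ n ] Vec (𝒜.Carrier n) k
  align []             = 0 , []
  align ((m , x) ∷ us) =
    let n , ys = align us in
    m ⊔ n , transition (left m n) x ∷ Vec.map (transition (right m n)) ys

  private
    -- Agreement of two aligned lists from some stage on.
    Agree : ∀ {k m n} → Vec (𝒜.Carrier m) k → Vec (𝒜.Carrier n) k → Set
    Agree {m = m} {n} xs ys =
      ∃[ p ] Σ (m ≤′ p) λ m≤p → Σ (n ≤′ p) λ n≤p →
        Pointwise (𝒜._≈_ p) (Vec.map (transition m≤p) xs) (Vec.map (transition n≤p) ys)

    shift : ∀ {k m m′ n n′ p q} {xs : Vec (𝒜.Carrier m) k} {ys : Vec (𝒜.Carrier n) k}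
            (m≤m′ : m ≤′ m′) (n≤n′ : n ≤′ n′) (m≤p : m ≤′ p) (n≤p : n ≤′ p) →
            Pointwise (𝒜._≈_ p) (Vec.map (transition m≤p) xs)
                                 (Vec.map (transition n≤p) ys) →
            p ≤′ q → (m′≤q : m′ ≤′ q) (n′≤q : n′ ≤′ q) →
            Pointwise (𝒜._≈_ q)
              (Vec.map (transition m′≤q) (Vec.map (transition m≤m′) xs))
              (Vec.map (transition n′≤q) (Vec.map (transition n≤n′) ys))
    shift {xs = []}     {[]}     _ _ _ _ [] _ _ _ = []
    shift {q = q} {xs = x ∷ xs} {y ∷ ys} a b c d (x≈y ∷ xs≈ys) e f g =
      𝒜.trans q (transition-∘ a f (≤′-trans a f) x)
        (𝒜.trans q (∼-later c d x≈y e (≤′-trans a f) (≤′-trans b g))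
          (𝒜.sym q (transition-∘ b g (≤′-trans b g) y)))
      ∷ shift a b c d xs≈ys e f g

    align-cong : ∀ {k} {us vs : Vec Element k} → Pointwise _∼_ us vs →
                 Agree (proj₂ (align us)) (proj₂ (align vs))
    align-cong [] = 0 , ≤′-refl , ≤′-refl , []
    align-cong {us = (m , x) ∷ us} {(n , y) ∷ vs} ((p , m≤p , n≤p , x≈y) ∷ us∼vs)
      with m′ , xs ← align us | n′ , ys ← align vs
         | q , m′≤q , n′≤q , xs≈ys ← align-cong us∼vs
      = r , M≤r , N≤r ,
        (𝒜.trans r (transition-∘ (left m m′) M≤r m≤r x)
          (𝒜.trans r (∼-later m≤p n≤p x≈y p≤r m≤r n≤r)
            (𝒜.sym r (transition-∘ (left n n′) N≤r n≤r y))))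
        ∷ shift (right m m′) (right n n′) m′≤q n′≤q xs≈ys q≤r M≤r N≤r
      where
      M = m ⊔ m′
      N = n ⊔ n′
      r = (p ⊔ q) ⊔ (M ⊔ N)
      p≤r : p ≤′ r
      p≤r = ≤′-trans (left p q) (left (p ⊔ q) (M ⊔ N))
      q≤r : q ≤′ r
      q≤r = ≤′-trans (right p q) (left (p ⊔ q) (M ⊔ N))
      M≤r : M ≤′ r
      M≤r = ≤′-trans (left M N) (right (p ⊔ q) (M ⊔ N))
      N≤r : N ≤′ r
      N≤r = ≤′-trans (right M N) (right (p ⊔ q) (M ⊔ N))
      m≤r : m ≤′ r
      m≤r = ≤′-trans m≤p p≤r
      n≤r : n ≤′ r
      n≤r = ≤′-trans n≤p p≤r

  limitInterp : ∀ s → Vec Element (arity s) → Element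
  limitInterp s us = let n , xs = align us in n , 𝒜.interp n s xs

  limitInterp-cong : ∀ s {us vs} → Pointwise _∼_ us vs →
                     limitInterp s us ∼ limitInterp s vs
  limitInterp-cong s {us} {vs} us∼vs =
    let p , m≤p , n≤p , eq = align-cong us∼vs in
    p , m≤p , n≤p ,
    𝒜.trans p (transition-preserve m≤p s (proj₂ (align us)))
      (𝒜.trans p (𝒜.interp-cong p s eq)
        (𝒜.sym p (transition-preserve n≤p s (proj₂ (align vs)))))

  directLimit : Algebra L
  directLimit = record
    { setoid      = limitSetoid
    ; interp      = limitInterp
    ; interp-cong = limitInterp-cong
    }

{-# OPTIONS --safe #-}
module Submission where

-- On Bool × ℕ let (c , i) ⋆ (d , j) be (not c , i) if i < j, and (c , i)
-- otherwise.  This operation is idempotent, and the pairs with i ≤ n form a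
-- finite subalgebra, the n-th stage of the system.  A sequence in a finite
-- algebra has a constant subsequence, and the finite reductions of a constant
-- sequence x, x, … in an idempotent algebra all equal x, so every stage is
-- Ramsey.  In the limit, start from the sequence (false , i), i ∈ ω.  An
-- orderly term only takes second components occurring among its arguments, so
-- every reduction a has a 0 strictly below a 1 in the second component; hence
-- a 0 and a 0 ⋆ a 1 are finite reductions of a with different colours.

open import Defs
open import Level using (0ℓ)
open import Axiom.ExcludedMiddle using (ExcludedMiddle)
open import Data.Bool.Base using (Bool; true; false; not; T; _xor_)
open import Data.Bool.Properties using (T-≡; xor-identityʳ; xor-comm)
open import Data.Fin.Base as Fin
  using (Fin; zero; suc; toℕ; fromℕ; inject₁; combine)
open import Data.Fin.Properties
  using (toℕ<n; toℕ-inject₁; toℕ-fromℕ; combine-injective; ¬∀⟶∃¬)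
open import Data.Nat.Base
  using (ℕ; zero; suc; _+_; _*_; _⊔_; _≤_; _<_; _<ᵇ_; _≤′_; ≤′-refl; ≤′-step; z<s; s<s)
open import Data.Nat.InfinitelyOften using (Inf)
open import Data.Nat.Properties
  using (≤-trans; <-trans; <-≤-trans; m≤m+n; m≤m⊔n; m≤n⊔m; ≤⇒≤′;
         +-monoʳ-<; <⇒<ᵇ; <⇒<′; <ᵇ⇒<; n≮n)
open import Data.Product using (Σ; ∃-syntax; _×_; _,_; proj₁; proj₂; map₂)
open import Data.Sum using (_⊎_; inj₁; inj₂)
open import Data.Vec.Base as Vec using (Vec; []; _∷_)
open import Data.Vec.Relation.Binary.Pointwise.Inductive using ([]; _∷_)
open import Data.Vec.Relation.Unary.All using (All; []; _∷_)
open import Data.Vec.Relation.Unary.All.Properties using (take⁺; drop⁺; tabulate⁺)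
open import Function.Base using (_∘_)
open import Function.Bundles using (Equivalence)
open import Relation.Binary.Bundles using (Setoid)
open import Relation.Binary.Definitions using (_Respects_)
open import Relation.Binary.PropositionalEquality
  using (_≡_; refl; sym; trans; cong; cong₂; setoid)
open import Relation.Nullary using (¬_; yes; no; contradiction)
open import Relation.Unary using (Pred; _⊆_; _⊥_)

<-stepwise : ∀ {f : ℕ → ℕ} → (∀ n → f n < f (suc n)) → ∀ {m n} → m < n → f m < f n
<-stepwise {f} step {m} = go ∘ <⇒<′
  where
  go : ∀ {n} → suc m ≤′ n → f m < f n
  go ≤′-refl       = step m
  go (≤′-step m<n) = <-trans (go m<n) (step _)

upperBound : ∀ {k} (f : Fin k → ℕ) → ∃[ N ] (∀ v → f v ≤ N)
upperBound {zero}  f = 0 , λ ()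
upperBound {suc k} f =
  let N , f≤N = upperBound (f ∘ suc) in
  f zero ⊔ N , λ { zero    → m≤m⊔n (f zero) N
                 ; (suc v) → ≤-trans (f≤N v) (m≤n⊔m (f zero) N) }

-- Orderly terms and finite reductions over an arbitrary family.

module Ramsey-properties (𝔸 : Setoid 0ℓ 0ℓ) where
  open Setoid 𝔸 renaming (Carrier to A; refl to ≈-refl; sym to ≈-sym; trans to ≈-trans)
  open Ramsey 𝔸

  Closed : Pred A 0ℓ → Family → Set
  Closed P 𝓕 = ∀ {n} {f : Op n} → 𝓕 f → ∀ {xs} → All P xs → P (f xs)

  applyBlocks⁺ : ∀ {P : Pred A 0ℓ} {k} (ns : Vec ℕ k) {hs : ∀ j → Op (Vec.lookup ns j)} →
                 (∀ j {xs} → All P xs → P (hs j xs)) →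
                 ∀ {xs} → All P xs → All P (applyBlocks ns hs xs)
  applyBlocks⁺ []       Phs pxs = []
  applyBlocks⁺ (n ∷ ns) Phs pxs =
    Phs zero (take⁺ n pxs) ∷ applyBlocks⁺ ns (Phs ∘ suc) (drop⁺ n pxs)

  -- Induction on orderly terms. Since an orderly composition is specified only up to `≈`, `P` has
  -- to respect `≈`. The two uses take for `P` the class of a single element and a bound on the
  -- possible positions of a term's value.
  OT-closed : ∀ {P : Pred A 0ℓ} {𝓕 : Family} → P Respects _≈_ →
              Closed P 𝓕 → Closed P (OT 𝓕)
  OT-closed resp closed (basic 𝓕f) pxs = closed 𝓕f pxs
  OT-closed resp closed identity (px ∷ []) = px
  OT-closed resp closed (compose (orderly {ns = ns} OTg OThs f≈)) {xs} pxs =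
    resp (≈-sym (f≈ xs))
      (OT-closed resp closed OTg
        (applyBlocks⁺ ns (λ j → OT-closed resp closed (OThs j)) pxs))

  -- A reduction is an infinite sequence, so the value of `f` on the first `n` entries of `a` is
  -- continued by the untouched entries from position `n` on.
  FR-term : ∀ {𝓕 : Family} {n} {f : Op n} → OT 𝓕 f → (a : Seq) →
            FR 𝓕 a (f (Vec.tabulate (a ∘ toℕ)))
  FR-term {𝓕} {n} {f} OTf a = b , b≤a , ≈-refl
    where
    b : Seq
    b zero    = f (Vec.tabulate (a ∘ toℕ))
    b (suc j) = a (n + j)

    length : ℕ → ℕ
    length zero    = n
    length (suc j) = 1

    index : ∀ j → Fin (length j) → ℕ
    index zero    p = toℕ p
    index (suc j) p = n + j

    within : ∀ j {p q} → p Fin.< q → index j p < index j q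
    within zero    p<q = p<q
    within (suc j) {zero} {zero} ()

    across : ∀ {i j} → i < j → ∀ p q → index i p < index j q
    across {zero}  {suc j} z<s       p q = <-≤-trans (toℕ<n p) (m≤m+n n j)
    across {suc i} {suc j} (s<s i<j) p q = +-monoʳ-< n i<j

    term : ∀ j → Op (length j)
    term zero    = f
    term (suc j) = Vec.head

    isTerm : ∀ j → OT 𝓕 (term j)
    isTerm zero    = OTf
    isTerm (suc j) = identity

    value : ∀ j → b j ≈ term j (Vec.tabulate (a ∘ index j))
    value zero    = ≈-refl
    value (suc j) = ≈-refl

    b≤a : Reduction 𝓕 b a
    b≤a = record { length = length ; index = index ; within = within ; across = across
                 ; term = term ; isTerm = isTerm ; value = value }

  -- The law f(x, ..., x) ≈ x for all arities at once, phrased as closure of the class of `x` so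
  -- that `OT-closed` extends it to orderly terms.
  Idempotent : Family → Set
  Idempotent 𝓕 = ∀ x → Closed (_≈ x) 𝓕

  FR-constant : ∀ {𝓕 : Family} → Idempotent 𝓕 → ∀ {x y} → FR 𝓕 (λ _ → x) y → y ≈ x
  FR-constant idem {x} (a , a≤x , a0≈y) =
    ≈-trans (≈-sym a0≈y) (≈-trans (value 0)
      (OT-closed (λ y≈z y≈x → ≈-trans (≈-sym y≈z) y≈x) (idem x) (isTerm 0)
        (tabulate⁺ λ _ → ≈-refl)))
    where open Reduction a≤x

  constant-reduction : ∀ {𝓕 : Family} {x} {b : Seq} →
                       (∀ N → ∃[ j ] (N ≤ j × b j ≈ x)) → Reduction 𝓕 (λ _ → x) b
  constant-reduction {𝓕} {x} {b} occurs = record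
    { length = λ _ → 1
    ; index  = λ j _ → pos j
    ; within = λ { j {zero} {zero} () }
    ; across = λ i<j _ _ → <-stepwise (λ j → proj₁ (proj₂ (occurs (suc (pos j))))) i<j
    ; term   = λ _ → Vec.head
    ; isTerm = λ _ → identity
    ; value  = λ j → ≈-sym (hit j)
    }
    where
    pos : ℕ → ℕ
    pos zero    = proj₁ (occurs 0)
    pos (suc j) = proj₁ (occurs (suc (pos j)))

    hit : ∀ j → b (pos j) ≈ x
    hit zero    = proj₂ (proj₂ (occurs 0))
    hit (suc j) = proj₂ (proj₂ (occurs (suc (pos j))))

-- Finite idempotent algebras are Ramsey.

module _ (em : ExcludedMiddle 0ℓ) where

  -- `Inf P` merely denies that `P` fails from some point on; excluded middle extracts actual
  -- witnesses.
  Inf⇒unbounded : ∀ {P : Pred ℕ 0ℓ} → Inf P → ∀ N → ∃[ j ] (N ≤ j × P j)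
  Inf⇒unbounded {P} inf N with em {∃[ j ] (N ≤ j × P j)}
  ... | yes found = found
  ... | no  none  = contradiction (N , λ j N≤j pj → none (j , N≤j , pj)) inf

  -- Infinite pigeonhole: if each of the `k` values stopped occurring from some index on, then at an
  -- index `N` above all these bounds `b N` could take no value.
  recurrent-value : ∀ {k} (b : ℕ → Fin k) → ∃[ v ] Inf (λ i → b i ≡ v)
  recurrent-value {k} b = ¬∀⟶∃¬ k _ (λ _ → em) λ bounded →
    let N , ≤N = upperBound (proj₁ ∘ bounded) in
    proj₂ (bounded (b N)) N (≤N (b N)) refl

  module _ (𝔸 : Setoid 0ℓ 0ℓ) where
    open Setoid 𝔸 renaming (Carrier to A; refl to ≈-refl; sym to ≈-sym; trans to ≈-trans)
    open Ramsey 𝔸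
    open Ramsey-properties 𝔸

    finite-idempotent-Ramsey : ∀ {𝓕 : Family} {k} (code : A → Fin k) →
      (∀ {x y} → code x ≡ code y → x ≈ y) → Idempotent 𝓕 → IsRamsey 𝓕
    finite-idempotent-Ramsey {𝓕} code code-injective idem b X resp =
      (λ _ → x) , constant-reduction occurs , homogeneous
      where
      inf = proj₂ (recurrent-value (code ∘ b))
      -- The map `code` need not be surjective and has no inverse at hand, so an element with the
      -- recurrent code is taken from `b` itself.
      x   = b (proj₁ (Inf⇒unbounded inf 0))

      occurs : ∀ N → ∃[ j ] (N ≤ j × b j ≈ x)
      occurs N =
        let j , N≤j , eq = Inf⇒unbounded inf N in
        j , N≤j , code-injective (trans eq (sym (proj₂ (proj₂ (Inf⇒unbounded inf 0)))))

      homogeneous : FR 𝓕 (λ _ → x) ⊆ X ⊎ FR 𝓕 (λ _ → x) ⊥ X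
      homogeneous with em {X x}
      ... | yes Xx = inj₁ λ y∈FR → resp (≈-sym (FR-constant idem y∈FR)) Xx
      ... | no ¬Xx = inj₂ λ (y∈FR , Xy) → ¬Xx (resp (FR-constant idem y∈FR) Xy)

-- The operation and the direct system of its finite stages.

infixl 7 _⋆_
_⋆_ : Bool × ℕ → Bool × ℕ → Bool × ℕ
(c , i) ⋆ (d , j) = c xor (i <ᵇ j) , i

⋆-idem : ∀ x → x ⋆ x ≡ x
⋆-idem (c , i) with i <ᵇ i in eq
... | false = cong (_, i) (xor-identityʳ c)
... | true  = contradiction (<ᵇ⇒< i i (Equivalence.from T-≡ eq)) (n≮n i)

⋆-flips : ∀ {x y} → proj₂ x < proj₂ y → proj₁ (x ⋆ y) ≡ not (proj₁ x)
⋆-flips {c , i} {d , j} i<j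
  rewrite Equivalence.to T-≡ (<⇒<ᵇ i<j) = xor-comm c true

data Symbol : Set where
  star : Symbol

language : Language
language = record { Symbol = Symbol ; arity = λ _ → 2 }

Stage : ℕ → Set
Stage n = Bool × Fin (suc n)

-- Comparing through `toℕ` makes `embed` turn this operation into `⋆` by mere computation, which
-- `value-interp` relies on.
stageOp : ∀ {n} → Vec (Stage n) 2 → Stage n
stageOp ((c , i) ∷ (d , j) ∷ []) = c xor (toℕ i <ᵇ toℕ j) , i

stage : ℕ → Algebra language
stage n = record
  { setoid      = setoid (Stage n)
  ; interp      = λ _ → stageOp
  ; interp-cong = λ { _ (refl ∷ refl ∷ []) → refl }
  }

inclusion : ∀ n → Hom (stage n) (stage (suc n))
inclusion n = record
  { to       = map₂ inject₁
  ; to-cong  = cong (map₂ inject₁)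
  ; preserve = λ { _ ((c , i) ∷ (d , j) ∷ []) →
      cong (_, inject₁ i)
        (cong (c xor_) (sym (cong₂ _<ᵇ_ (toℕ-inject₁ i) (toℕ-inject₁ j)))) }
  }

system : DirectSystem language
system = record { algebra = stage ; hom = inclusion }

embed : ∀ {n} → Stage n → Bool × ℕ
embed = map₂ toℕ

stage-idempotent : ∀ {n} (x : Stage n) → stageOp (x ∷ x ∷ []) ≡ x
stage-idempotent (c , i) = cong (_, i) (cong proj₁ (⋆-idem (c , toℕ i)))

stage-Ramsey : ExcludedMiddle 0ℓ → ∀ n → IsRamseyAlgebra (stage n)
stage-Ramsey em n =
  finite-idempotent-Ramsey em (setoid (Stage n)) code code-injective
    λ { x (interpretation star) (refl ∷ refl ∷ []) → stage-idempotent x }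
  where
  bit : Bool → Fin 2
  bit false = zero
  bit true  = suc zero

  bit-injective : ∀ {c d} → bit c ≡ bit d → c ≡ d
  bit-injective {false} {false} _ = refl
  bit-injective {true}  {true}  _ = refl

  code : Stage n → Fin (2 * suc n)
  code (c , i) = combine (bit c) i

  code-injective : ∀ {x y} → code x ≡ code y → x ≡ y
  code-injective {c , i} {d , j} eq =
    let c≡d , i≡j = combine-injective (bit c) i (bit d) j eq in
    cong₂ _,_ (bit-injective c≡d) i≡j

-- The direct limit, read through its values in `Bool × ℕ`.

limit : Algebra language
limit = directLimit system

open Algebra limit using () renaming (Carrier to Limit; _≈_ to _≈∞_; setoid to limitSetoid∞)

value : Limit → Bool × ℕ
value (_ , x) = embed x

colour : Limit → Bool
colour = proj₁ ∘ value

position : Limit → ℕ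
position = proj₂ ∘ value

embed-transition : ∀ {m n} (m≤n : m ≤′ n) x → embed (transition system m≤n x) ≡ embed x
embed-transition ≤′-refl       x = refl
embed-transition (≤′-step m≤n) x =
  trans (cong (proj₁ y ,_) (toℕ-inject₁ (proj₂ y))) (embed-transition m≤n x)
  where y = transition system m≤n x

-- Transitions preserve `embed`, so `value` does not depend on the stage representing an element of
-- the limit.
value-cong : ∀ {u v} → u ≈∞ v → value u ≡ value v
value-cong {_ , x} {_ , y} (_ , m≤p , n≤p , eq) =
  trans (sym (embed-transition m≤p x)) (trans (cong embed eq) (embed-transition n≤p y))

value-interp : ∀ u v → value (Algebra.interp limit star (u ∷ v ∷ [])) ≡ value u ⋆ value v
value-interp (m , x) (n , y) =
  cong₂ _⋆_
    -- The function `align` starts from stage 0 at the empty list: `y` moves first to stage `n ⊔ 0`,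
    -- then to `m ⊔ (n ⊔ 0)`, while `x` moves only once.
    (embed-transition (≤⇒≤′ (m≤m⊔n m (n ⊔ 0))) x)
    (trans (embed-transition (≤⇒≤′ (m≤n⊔m m (n ⊔ 0))) (transition system n≤n⊔0 y))
           (embed-transition n≤n⊔0 y))
  where n≤n⊔0 = ≤⇒≤′ (m≤m⊔n n 0)

limit-not-Ramsey : ¬ IsRamseyAlgebra limit
limit-not-Ramsey ramsey = refute (proj₂ (proj₂ (ramsey generators Red Red-resp)))
  where
  open Ramsey limitSetoid∞
  open Ramsey-properties limitSetoid∞

  generators : Seq
  -- The i-th generator has position i, the top one of stage i, so indices in the sequence can be
  -- read off as positions.
  generators i = i , false , fromℕ i

  Red : Pred Limit 0ℓ
  Red u = colour u ≡ true

  Red-resp : Red Respects _≈∞_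
  Red-resp u≈v = trans (cong proj₁ (sym (value-cong u≈v)))

  a = proj₁ (ramsey generators Red Red-resp)
  open Reduction (proj₁ (proj₂ (ramsey generators Red Red-resp))) renaming (value to a≈)

  -- The operation keeps the position of its left argument, so the set of elements whose position is
  -- one of the indices used for `a j` is closed under it.
  position-a : ∀ j → ∃[ p ] (position (a j) ≡ index j p)
  position-a j =
    map₂ (trans (cong proj₂ (value-cong (a≈ j))))
      (OT-closed {P = λ u → ∃[ p ] (position u ≡ index j p)}
        (λ u≈v → map₂ (trans (cong proj₂ (sym (value-cong u≈v)))))
        (λ { (interpretation star) {u ∷ v ∷ []} (pu ∷ _) →
               map₂ (trans (cong proj₂ (value-interp u v))) pu })
        (isTerm j)
        (tabulate⁺ λ p → p , toℕ-fromℕ (index j p)))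

  increasing : position (a 0) < position (a 1)
  increasing with position-a 0 | position-a 1
  -- The block of indices used for `a 0` lies entirely before the one used for `a 1`, whichever `p`
  -- and `q` arise.
  ... | p , eq | q , eq′ rewrite eq | eq′ = across z<s p q

  a0⋆a1 : Limit
  a0⋆a1 = Algebra.interp limit star (a 0 ∷ a 1 ∷ [])

  flipped : colour a0⋆a1 ≡ not (colour (a 0))
  flipped = trans (cong proj₁ (value-interp (a 0) (a 1))) (⋆-flips {value (a 0)} {value (a 1)} increasing)

  a0∈FR : FR (Operation limit) a (a 0)
  a0∈FR = FR-term identity a

  a0⋆a1∈FR : FR (Operation limit) a a0⋆a1
  a0⋆a1∈FR = FR-term (basic (interpretation star)) a

  refute : ¬ (FR (Operation limit) a ⊆ Red ⊎ FR (Operation limit) a ⊥ Red)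
  refute (inj₁ FR⊆Red)
    with trans (sym (FR⊆Red a0⋆a1∈FR)) (trans flipped (cong not (FR⊆Red a0∈FR)))
  ... | ()
  refute (inj₂ FR⊥Red) with colour (a 0) in eq
  ... | true  = FR⊥Red (a0∈FR , eq)
  ... | false = FR⊥Red (a0⋆a1∈FR , trans flipped (cong not eq))

theorem5p8 : ExcludedMiddle 0ℓ →
    Σ Language λ L →
    Σ (DirectSystem L) λ 𝒮 →
    (∀ n → IsRamseyAlgebra (DirectSystem.algebra 𝒮 n)) ×
    ¬ IsRamseyAlgebra (directLimit 𝒮)
theorem5p8 em = language , system , stage-Ramsey em , limit-not-Ramsey
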